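{- Given a small field $K$ and a small, nonzero $K$-vector space $V$, the $\mathfrak{Small}$-ary double centralizer clone $(\Sigma^V)^{\perp\perp(\mathfrak{Small})}$ of $V$ is equal to the clone of $\mathfrak{Small}$-ary derived operations $\langle \Sigma^V\rangle$ of $V$, where $\Sigma$ is the usual signature for $K$-vector spaces.
   Context: Fix a Grothendieck universe $\mathfrak{Small}$, i.e. the set of all sets of rank less than a fixed inaccessible cardinal; its elements are called small sets. $\Sigma$ is the signature consisting of a binary operation symbol $+$, a constant symbol $0$, a unary operation symbol $-$, and a unary operation symbol $c$ for each $c\in K$ (scalar multiplication by $c$). $\Sigma^V$ denotes the set of the corresponding basic operations on $V$. A $\mathfrak{Small}$-ary operation on a set $A$ is a map $A^X \to A$ with $X$ a small set (its arity); nullary operations are allowed. A $\mathfrak{Small}$-ary clone on $A$ is a set $F$ of $\mathfrak{Small}$-ary operations on $A$ that contains all projections $\pi_x:A^X\to A$ ($X$ small, $x\in X$) and is such that for all small $X,Y$, every $f:A^Y\to A$ in $F$ and every family $g_y:A^X\to A$ $(y\in Y)$ in $F$, the composite $f\circ(g_y)_{y\in Y}:A^X\to A$ lies in $F$. The clone of $\mathfrak{Small}$-ary derived operations $\langle\Sigma^V\rangle$ is the smallest $\mathfrak{Small}$-ary clone on $V$ containing $\Sigma^V$. Operations $f:A^X\to A$ and $g:A^Y\to A$ commute, written $f\perp g$, if for every matrix $a=(a_{xy})\in A^{X\times Y}$ one has $g\bigl((f((a_{xy})_{x\in X}))_{y\in Y}\bigr)=f\bigl((g((a_{xy})_{y\in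 Y}))_{x\in X}\bigr)$. For a set $G$ of $\mathfrak{Small}$-ary operations on $A$, $G^{\perp(\mathfrak{Small})}$ is the set of all $\mathfrak{Small}$-ary operations $f$ on $A$ with $f\perp g$ for all $g\in G$, and $G^{\perp\perp(\mathfrak{Small})}$ is the result of applying $(-)^{\perp(\mathfrak{Small})}$ twice to $G$. -}

module Defs where

open import Level using (Level; Lift; lift; suc; _⊔_)
open import Algebra.Bundles using (CommutativeRing)
open import Algebra.Module.Bundles using (Module)
open import Data.Fin.Base using (Fin) renaming (zero to fzero; suc to fsuc)
open import Data.Nat.Base using (ℕ)
open import Data.Product.Base using (_×_; ∃-syntax)
open import Function.Bundles using (Func)
open import Function.Indexed.Relation.Binary.Equality using (≡-setoid)
open import Relation.Binary.Bundles using (Setoid)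
open import Relation.Binary.Indexed.Heterogeneous.Construct.Trivial using (indexedSetoid)
open import Relation.Nullary.Negation.Core using (¬_)
open import Relation.Unary using (Pred; _∈_; _⊆_)

-- The small sets are the types in `Set ℓ`; "sets" carry a setoid equality, and
-- an operation is a map A^X → A that respects it.

module Operations {ℓ : Level} (A : Setoid ℓ ℓ) where

  open Setoid A

  Power : Set ℓ → Setoid ℓ ℓ
  Power X = ≡-setoid X (indexedSetoid A)

  Operation : Set ℓ → Set ℓ
  Operation X = Func (Power X) A

  infixl 20 _⟨$⟩_
  _⟨$⟩_ : ∀ {X} → Operation X → (X → Carrier) → Carrier
  f ⟨$⟩ a = Func.to f a

  infix 4 _≈ₒ_
  _≈ₒ_ : ∀ {X} → Operation X → Operation X → Set ℓ
  f ≈ₒ g = ∀ a → f ⟨$⟩ a ≈ g ⟨$⟩ a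

  π : ∀ {X} → X → Operation X
  π x = record { to = λ a → a x ; cong = λ a≈b → a≈b x }

  compose : ∀ {X Y} → Operation Y → (Y → Operation X) → Operation X
  compose f g = record { to = λ a → f ⟨$⟩ (λ y → g y ⟨$⟩ a)
                     ; cong = λ a≈b → Func.cong f (λ y → Func.cong (g y) a≈b) }

  OperationSet : (p : Level) → Set (suc ℓ ⊔ suc p)
  OperationSet p = ∀ X → Pred (Operation X) p

  -- `resp` says that membership depends only on an operation as an element of
  -- the function setoid, as for any subset of a setoid.
  record IsClone {p} (F : OperationSet p) : Set (suc ℓ ⊔ p) where
    field
      resp            : ∀ {X} {f g : Operation X} → f ≈ₒ g → f ∈ F X → g ∈ F X
      hasProjections  : ∀ {X} (x : X) → π x ∈ F X
      closedUnderComp : ∀ {X Y} (f : Operation Y) (g : Y → Operation X) →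
                        f ∈ F Y → (∀ y → g y ∈ F X) → compose f g ∈ F X

  -- The smallest clone containing G: `⟨⟩-isClone`, `⟨⟩-contains` and `⟨⟩-least`
  -- below are the defining properties.
  data ⟨_⟩ {p} (G : OperationSet p) : OperationSet (suc ℓ ⊔ p) where
    gen  : ∀ {X} {f : Operation X} → f ∈ G X → f ∈ ⟨ G ⟩ X
    resp : ∀ {X} {f g : Operation X} → f ≈ₒ g → f ∈ ⟨ G ⟩ X → g ∈ ⟨ G ⟩ X
    proj : ∀ {X} (x : X) → π x ∈ ⟨ G ⟩ X
    comp : ∀ {X Y} (f : Operation Y) (g : Y → Operation X) →
           f ∈ ⟨ G ⟩ Y → (∀ y → g y ∈ ⟨ G ⟩ X) → compose f g ∈ ⟨ G ⟩ X

  ⟨⟩-isClone : ∀ {p} (G : OperationSet p) → IsClone ⟨ G ⟩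
  ⟨⟩-isClone G = record
    { resp = resp ; hasProjections = proj ; closedUnderComp = comp }

  ⟨⟩-contains : ∀ {p} (G : OperationSet p) X → G X ⊆ ⟨ G ⟩ X
  ⟨⟩-contains G X = gen

  ⟨⟩-least : ∀ {p q} {G : OperationSet p} {F : OperationSet q} → IsClone F →
             (∀ X → G X ⊆ F X) → ∀ X → ⟨ G ⟩ X ⊆ F X
  ⟨⟩-least F-clone G⊆F X (gen f∈G)        = G⊆F X f∈G
  ⟨⟩-least F-clone G⊆F X (resp f≈g f∈)    =
    IsClone.resp F-clone f≈g (⟨⟩-least F-clone G⊆F X f∈)
  ⟨⟩-least F-clone G⊆F X (proj x)         = IsClone.hasProjections F-clone x
  ⟨⟩-least F-clone G⊆F X (comp f g f∈ g∈) =
    IsClone.closedUnderComp F-clone f g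
      (⟨⟩-least F-clone G⊆F _ f∈) (λ y → ⟨⟩-least F-clone G⊆F X (g∈ y))

  infix 4 _⊥_
  _⊥_ : ∀ {X Y} → Operation X → Operation Y → Set ℓ
  _⊥_ {X} {Y} f g = ∀ (a : X → Y → Carrier) →
    g ⟨$⟩ (λ y → f ⟨$⟩ (λ x → a x y)) ≈ f ⟨$⟩ (λ x → g ⟨$⟩ (λ y → a x y))

  infix 25 _^⊥ _^⊥⊥
  _^⊥ : ∀ {p} → OperationSet p → OperationSet (suc ℓ ⊔ p)
  (G ^⊥) X f = ∀ {Y} (g : Operation Y) → g ∈ G Y → f ⊥ g

  _^⊥⊥ : ∀ {p} → OperationSet p → OperationSet (suc ℓ ⊔ p)
  G ^⊥⊥ = (G ^⊥) ^⊥

module _ {c ℓ} (R : CommutativeRing c ℓ) where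

  open CommutativeRing R

  record IsField : Set (c ⊔ ℓ) where
    field
      nontrivial : ¬ (1# ≈ 0#)
      inverse    : ∀ x → ¬ (x ≈ 0#) → ∃[ y ] x * y ≈ 1#

module VectorSpace {ℓ : Level} (K : CommutativeRing ℓ ℓ) (V : Module K ℓ ℓ) where

  open CommutativeRing K using () renaming (Carrier to Scalar)
  open Module V
  open Operations ≈ᴹ-setoid public

  Nonzero : Set ℓ
  Nonzero = ∃[ v ] ¬ (v ≈ᴹ 0ᴹ)

  data Symbol : Set ℓ where
    add zero neg : Symbol
    scale        : Scalar → Symbol

  arity : Symbol → ℕ
  arity add       = 2
  arity zero      = 0
  arity neg       = 1
  arity (scale c) = 1

  ⟦_⟧ : (s : Symbol) → Operation (Lift ℓ (Fin (arity s)))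
  ⟦ add ⟧     = record { to = λ a → a (lift fzero) +ᴹ a (lift (fsuc fzero))
                     ; cong = λ a≈b → +ᴹ-cong (a≈b _) (a≈b _) }
  ⟦ zero ⟧    = record { to = λ a → 0ᴹ ; cong = λ _ → ≈ᴹ-refl }
  ⟦ neg ⟧     = record { to = λ a → -ᴹ a (lift fzero) ; cong = λ a≈b → -ᴹ‿cong (a≈b _) }
  ⟦ scale c ⟧ = record { to = λ a → c *ₗ a (lift fzero)
                     ; cong = λ a≈b → *ₗ-cong (CommutativeRing.refl K) (a≈b _) }

  data Σⱽ : OperationSet (suc ℓ) where
    basic : ∀ s {f} → f ≈ₒ ⟦ s ⟧ → f ∈ Σⱽ (Lift ℓ (Fin (arity s)))

{-# OPTIONS --safe #-}
-- An operation f in the double centralizer that is no finite linear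
-- combination of projections is separated from them, inside the space of all
-- maps V^X → V, by a linear functional φ with φ(π_x) = 0 and φ(f) = 1. For
-- v ≠ 0 the map φ(-)v is then a linear operation whose arity is the set V^X;
-- since f commutes with it, v = φ(f)v = f(φ(π_x)v)_x = f(0) = 0.
-- Separation comes from a subspace maximal among those that contain the
-- projections but not f; it is a hyperplane.
module Submission where

open import Level using (Level; Lift; lift; _⊔_)
open import Algebra.Bundles using (CommutativeMonoid; CommutativeRing; Ring)
import Algebra.Construct.Pointwise as Pointwise
open import Algebra.Module.Bundles using (Module; LeftModule)
import Algebra.Properties.CommutativeSemigroup as CommutativeSemigroupProperties
import Algebra.Properties.Group as GroupProperties
import Algebra.Properties.Ring as RingProperties
open import Axiom.ExcludedMiddle using (ExcludedMiddle)
open import Axiom.Extensionality.Propositional using (Extensionality; lower-extensionality)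
open import Data.Bool.Base using (Bool; true; false; T)
open import Data.Empty using (⊥-elim)
open import Data.Fin.Base using (Fin) renaming (zero to fzero; suc to fsuc)
open import Data.Product.Base using (_×_; _,_; ∃-syntax; proj₁; proj₂)
open import Data.Sum.Base using (_⊎_; inj₁; inj₂)
open import Function.Base using (_∘_; id; case_of_)
open import Function.Bundles using (Func)
open import Relation.Binary.Bundles using (Setoid)
open import Relation.Binary.PropositionalEquality.Core as ≡ using (_≡_)
import Relation.Binary.Reasoning.Setoid as SetoidReasoning
open import Relation.Nullary.Decidable.Core
  using (Dec; yes; no; isYes; toWitness; fromWitness; decidable-stable)
open import Relation.Nullary.Negation.Core using (¬_)
open import Relation.Unary using (Pred; _∈_; _⊆_; _≐_)
open import Defs

-- Zorn's lemma for subsets ordered by inclusion.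

-- Subsets are Bool-valued, so that under excluded middle the power set of a
-- type in Set ℓ is again a type in Set ℓ, and quantification over subsets
-- stays within reach of `ExcludedMiddle ℓ`.
module Zorn {ℓ : Level} (em : ExcludedMiddle ℓ) (ext : Extensionality ℓ ℓ) where

  infix 4 _∈ᵇ_ _⊆ᵇ_

  _∈ᵇ_ : {A : Set ℓ} → A → (A → Bool) → Set
  x ∈ᵇ P = T (P x)

  _⊆ᵇ_ : {A : Set ℓ} → (A → Bool) → (A → Bool) → Set ℓ
  P ⊆ᵇ Q = ∀ x → x ∈ᵇ P → x ∈ᵇ Q

  ⟦_⟧ᵇ : {A : Set ℓ} → Pred A ℓ → A → Bool
  ⟦ P ⟧ᵇ x = isYes (em {P x})

  module _ {A : Set ℓ} (P : Pred A ℓ) {x : A} where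

    ∈⟦⟧⁺ : P x → x ∈ᵇ ⟦ P ⟧ᵇ
    ∈⟦⟧⁺ = fromWitness

    ∈⟦⟧⁻ : x ∈ᵇ ⟦ P ⟧ᵇ → P x
    ∈⟦⟧⁻ = toWitness

  T-antisym : ∀ {b c} → (T b → T c) → (T c → T b) → b ≡ c
  T-antisym {false} {false} _   _   = ≡.refl
  T-antisym {false} {true}  _   c⇒b = ⊥-elim (c⇒b _)
  T-antisym {true}  {false} b⇒c _   = ⊥-elim (b⇒c _)
  T-antisym {true}  {true}  _   _   = ≡.refl

  -- Extensionality enters here. Propositional equality, rather than mutual inclusion, is what lets
  -- an arbitrary `next`, chosen without regard to inclusion, be transported in `next-cong`.
  ⊆ᵇ-antisym : {A : Set ℓ} {P Q : A → Bool} → P ⊆ᵇ Q → Q ⊆ᵇ P → P ≡ Q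
  ⊆ᵇ-antisym P⊆Q Q⊆P =
    lower-extensionality ℓ ℓ ext λ x → T-antisym (P⊆Q x) (Q⊆P x)

  ⋃ : {A : Set ℓ} → ((A → Bool) → Bool) → A → Bool
  ⋃ I = ⟦ (λ x → ∃[ P ] P ∈ᵇ I × x ∈ᵇ P) ⟧ᵇ

  module _ {A : Set ℓ} (I : (A → Bool) → Bool) where

    ∈⋃⁻ : ∀ {x} → x ∈ᵇ ⋃ I → ∃[ P ] P ∈ᵇ I × x ∈ᵇ P
    ∈⋃⁻ = ∈⟦⟧⁻ λ x → ∃[ P ] P ∈ᵇ I × x ∈ᵇ P

    ⊆⋃ : ∀ {P} → P ∈ᵇ I → P ⊆ᵇ ⋃ I
    ⊆⋃ P∈I x x∈P = ∈⟦⟧⁺ (λ x → ∃[ P ] P ∈ᵇ I × x ∈ᵇ P) (_ , P∈I , x∈P)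

    ⋃⊆ : ∀ {Q} → (∀ P → P ∈ᵇ I → P ⊆ᵇ Q) → ⋃ I ⊆ᵇ Q
    ⋃⊆ I⊆Q x x∈⋃ with ∈⋃⁻ x∈⋃
    ... | P , P∈I , x∈P = I⊆Q P P∈I x x∈P

  module Tower {A : Set ℓ} (base : A → Bool) (next : (A → Bool) → A → Bool)
               (next-⊇ : ∀ P → P ⊆ᵇ next P) where

    -- Transfinite iteration of `next` without ordinals. Unions are taken over inhabited families,
    -- since the empty union would be a stage that need not contain `base`.
    data Stage : (A → Bool) → Set ℓ where
      start : Stage base
      step  : ∀ {P} → Stage P → Stage (next P)
      limit : ∀ I → ∃[ P ] P ∈ᵇ I → (∀ P → P ∈ᵇ I → Stage P) → Stage (⋃ I)

    base⊆ : ∀ {P} → Stage P → base ⊆ᵇ P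
    base⊆ start                         = λ x → id
    base⊆ (step {P} s)                  = λ x → next-⊇ P x ∘ base⊆ s x
    base⊆ (limit I (P , P∈I) stages)    = λ x → ⊆⋃ I P∈I x ∘ base⊆ (stages P P∈I) x

    private
      -- Comparability along the stages goes through extreme stages, as in the
      -- Bourbaki–Witt theorem.
      Extreme : (A → Bool) → Set ℓ
      Extreme P = ∀ {Q} → Stage Q → Q ⊆ᵇ P → P ⊆ᵇ Q ⊎ next Q ⊆ᵇ P

      next-cong : ∀ {P Q} → P ⊆ᵇ Q → Q ⊆ᵇ P → next P ⊆ᵇ next Q
      next-cong P⊆Q Q⊆P with ≡.refl ← ⊆ᵇ-antisym P⊆Q Q⊆P = λ x → id

      compare : ∀ {P} → Stage P → Extreme P → ∀ {Q} → Stage Q → Q ⊆ᵇ P ⊎ next P ⊆ᵇ Q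
      compare p ex start = inj₁ (base⊆ p)
      compare p ex (step {Q} q) with compare p ex q
      ... | inj₂ nP⊆Q = inj₂ λ x → next-⊇ Q x ∘ nP⊆Q x
      -- Extremeness of `P` excludes that `next Q` jumps past `P`: either `Q` has already reached
      -- `P`, or `next Q` is still inside it.
      ... | inj₁ Q⊆P with ex q Q⊆P
      ...   | inj₁ P⊆Q  = inj₂ (next-cong P⊆Q Q⊆P)
      ...   | inj₂ nQ⊆P = inj₁ nQ⊆P
      compare {P} p ex (limit I _ stages) with em {∃[ R ] R ∈ᵇ I × next P ⊆ᵇ R}
      ... | yes (R , R∈I , nP⊆R) = inj₂ λ x → ⊆⋃ I R∈I x ∘ nP⊆R x
      ... | no ∄R = inj₁ (⋃⊆ I below)
        where
        below : ∀ R → R ∈ᵇ I → R ⊆ᵇ P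
        below R R∈I with compare p ex (stages R R∈I)
        ... | inj₁ R⊆P  = R⊆P
        ... | inj₂ nP⊆R = ⊥-elim (∄R (R , R∈I , nP⊆R))

      extreme : ∀ {P} → Stage P → Extreme P
      extreme start q Q⊆P = inj₁ (base⊆ q)
      extreme (step {P} p) q Q⊆nP with compare p (extreme p) q
      ... | inj₂ nP⊆Q = inj₁ nP⊆Q
      ... | inj₁ Q⊆P with extreme p q Q⊆P
      ...   | inj₁ P⊆Q  = inj₂ (next-cong Q⊆P P⊆Q)
      ...   | inj₂ nQ⊆P = inj₂ λ x → next-⊇ P x ∘ nQ⊆P x
      extreme (limit I i stages) {Q} q Q⊆⋃ with em {∃[ R ] R ∈ᵇ I × Q ⊆ᵇ R}
      ... | no ∄R = inj₁ (⋃⊆ I below)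
        where
        below : ∀ R → R ∈ᵇ I → R ⊆ᵇ Q
        below R R∈I with compare (stages R R∈I) (extreme (stages R R∈I)) q
        ... | inj₁ Q⊆R  = ⊥-elim (∄R (R , R∈I , Q⊆R))
        ... | inj₂ nR⊆Q = λ x → nR⊆Q x ∘ next-⊇ R x
      ... | yes (R , R∈I , Q⊆R) with extreme (stages R R∈I) q Q⊆R
      ...   | inj₂ nQ⊆R = inj₂ λ x → ⊆⋃ I R∈I x ∘ nQ⊆R x
      -- Here `Q` and `R` coincide, so it remains to decide whether the union stops at `R` or
      -- contains `next R`. The recursion stays well-founded because extremeness is invoked only for
      -- the member `R`.
      ...   | inj₁ R⊆Q with compare (stages R R∈I) (extreme (stages R R∈I)) (limit I i stages)
      ...     | inj₁ ⋃⊆R  = inj₁ λ x → R⊆Q x ∘ ⋃⊆R x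
      ...     | inj₂ nR⊆⋃ = inj₂ λ x → nR⊆⋃ x ∘ next-cong Q⊆R R⊆Q x

    total : ∀ {P Q} → Stage P → Stage Q → P ⊆ᵇ Q ⊎ Q ⊆ᵇ P
    total {P} p q with compare p (extreme p) q
    ... | inj₁ Q⊆P  = inj₂ Q⊆P
    ... | inj₂ nP⊆Q = inj₁ λ x → nP⊆Q x ∘ next-⊇ P x

    top : A → Bool
    top = ⋃ ⟦ Stage ⟧ᵇ

    -- The family of all stages is itself Bool-valued and contains `base`, so `limit` admits it.
    -- Hence there is a greatest stage, and `next` cannot leave it.
    top-stage : Stage top
    top-stage = limit _ (base , ∈⟦⟧⁺ Stage start) λ P → ∈⟦⟧⁻ Stage

    next-top⊆ : next top ⊆ᵇ top
    next-top⊆ = ⊆⋃ ⟦ Stage ⟧ᵇ (∈⟦⟧⁺ Stage (step top-stage))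

  Chain : {A : Set ℓ} → ((A → Bool) → Bool) → Set ℓ
  Chain I = ∀ P Q → P ∈ᵇ I → Q ∈ᵇ I → P ⊆ᵇ Q ⊎ Q ⊆ᵇ P

  ⋃-Closed : {A : Set ℓ} → Pred (A → Bool) ℓ → Set ℓ
  ⋃-Closed Good = ∀ I → ∃[ P ] P ∈ᵇ I → Chain I → (∀ P → P ∈ᵇ I → Good P) → Good (⋃ I)

  -- Iterating a chosen enlargement from `base` runs through a chain of good subsets. At the top
  -- stage the enlargement adds nothing, which rules out any strictly bigger good subset.
  zorn : {A : Set ℓ} (Good : Pred (A → Bool) ℓ) → ⋃-Closed Good →
         ∀ {base} → Good base →
         ∃[ M ] Good M × base ⊆ᵇ M × (∀ Q → Good Q → M ⊆ᵇ Q → Q ⊆ᵇ M)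
  zorn {A} Good ⋃-good {base} base-good =
    top , good top-stage , base⊆ top-stage , maximal
    where
    Bigger : (A → Bool) → Set ℓ
    Bigger P = ∃[ Q ] Good Q × P ⊆ᵇ Q × ¬ (Q ⊆ᵇ P)

    -- `em` decides arbitrary types, not just propositions, and so acts as a
    -- choice function for the strictly bigger good subsets.
    enlarge : ∀ {P} → Dec (Bigger P) → A → Bool
    enlarge     (yes (Q , _)) = Q
    enlarge {P} (no _)        = P

    enlarge-⊇ : ∀ {P} (d : Dec (Bigger P)) → P ⊆ᵇ enlarge d
    enlarge-⊇ (yes (_ , _ , P⊆Q , _)) = P⊆Q
    enlarge-⊇ (no _)                  = λ x → id

    enlarge-good : ∀ {P} (d : Dec (Bigger P)) → Good P → Good (enlarge d)
    enlarge-good (yes (_ , Q-good , _)) _      = Q-good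
    enlarge-good (no _)                 P-good = P-good

    enlarge-maximal : ∀ {P} (d : Dec (Bigger P)) → enlarge d ⊆ᵇ P → ¬ Bigger P
    enlarge-maximal (yes (_ , _ , _ , Q⊈P)) Q⊆P = ⊥-elim (Q⊈P Q⊆P)
    enlarge-maximal (no ¬bigger)            _   = ¬bigger

    open Tower base (λ P → enlarge (em {Bigger P})) (λ P → enlarge-⊇ em)

    good : ∀ {P} → Stage P → Good P
    good start              = base-good
    good (step p)           = enlarge-good em (good p)
    good (limit I i stages) =
      ⋃-good I i (λ P Q P∈I Q∈I → total (stages P P∈I) (stages Q Q∈I))
        (λ P P∈I → good (stages P P∈I))

    maximal : ∀ Q → Good Q → top ⊆ᵇ Q → Q ⊆ᵇ top
    maximal Q Q-good top⊆Q with em {Q ⊆ᵇ top}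
    ... | yes Q⊆top = Q⊆top
    ... | no  Q⊈top =
      ⊥-elim (enlarge-maximal em next-top⊆ (Q , Q-good , top⊆Q , Q⊈top))

-- Modules of maps, subspaces, and coordinates modulo a subspace.

pointwise : ∀ {a r ℓr m ℓm} {R : Ring r ℓr} (A : Set a) →
            LeftModule R m ℓm → LeftModule R _ _
pointwise A M = record
  { isLeftModule = record
    { isLeftSemimodule = record
      { +ᴹ-isCommutativeMonoid = Pointwise.isCommutativeMonoid A M.+ᴹ-isCommutativeMonoid
      ; isPreleftSemimodule = record
        { *ₗ-cong      = λ x≈y f≈g a → M.*ₗ-cong x≈y (f≈g a)
        ; *ₗ-zeroˡ     = λ f a → M.*ₗ-zeroˡ (f a)
        ; *ₗ-distribʳ  = λ f x y a → M.*ₗ-distribʳ (f a) x y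
        ; *ₗ-identityˡ = λ f a → M.*ₗ-identityˡ (f a)
        ; *ₗ-assoc     = λ x y f a → M.*ₗ-assoc x y (f a)
        ; *ₗ-zeroʳ     = λ x a → M.*ₗ-zeroʳ x
        ; *ₗ-distribˡ  = λ x f g a → M.*ₗ-distribˡ x (f a) (g a)
        }
      }
    ; -ᴹ‿cong    = λ f≈g a → M.-ᴹ‿cong (f≈g a)
    ; -ᴹ‿inverse = (λ f a → M.-ᴹ‿inverseˡ (f a)) , (λ f a → M.-ᴹ‿inverseʳ (f a))
    }
  }
  where module M = LeftModule M

module _ {r ℓr m ℓm} {R : Ring r ℓr} (E : LeftModule R m ℓm) where

  open Ring R using (_+_; _*_; -_; 0#; 1#; _≈_)
  open LeftModule E

  record IsSubspace {p} (S : Pred Carrierᴹ p) : Set (r ⊔ m ⊔ ℓm ⊔ p) where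
    field
      resp      : ∀ {x y} → x ≈ᴹ y → S x → S y
      0ᴹ-closed : S 0ᴹ
      +ᴹ-closed : ∀ {x y} → S x → S y → S (x +ᴹ y)
      *ₗ-closed : ∀ k {x} → S x → S (k *ₗ x)

  record IsFunctional (φ : Carrierᴹ → Ring.Carrier R) : Set (r ⊔ ℓr ⊔ m ⊔ ℓm) where
    field
      cong    : ∀ {x y} → x ≈ᴹ y → φ x ≈ φ y
      +ᴹ-homo : ∀ x y → φ (x +ᴹ y) ≈ φ x + φ y
      *ₗ-homo : ∀ k x → φ (k *ₗ x) ≈ k * φ x

  open SetoidReasoning ≈ᴹ-setoid
  open GroupProperties +ᴹ-group using (inverseˡ-unique)
  open CommutativeSemigroupProperties
    (CommutativeMonoid.commutativeSemigroup +ᴹ-commutativeMonoid)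
    using (interchange)

  -1*ₗ : ∀ x → (- 1#) *ₗ x ≈ᴹ -ᴹ x
  -1*ₗ x = inverseˡ-unique _ x (begin
    (- 1#) *ₗ x +ᴹ x        ≈⟨ +ᴹ-congˡ (*ₗ-identityˡ x) ⟨
    (- 1#) *ₗ x +ᴹ 1# *ₗ x  ≈⟨ *ₗ-distribʳ x (- 1#) 1# ⟨
    (- 1# + 1#) *ₗ x        ≈⟨ *ₗ-congʳ (Ring.-‿inverseˡ R 1#) ⟩
    0# *ₗ x                 ≈⟨ *ₗ-zeroˡ x ⟩
    0ᴹ                      ∎)

  *ₗ-invertible : ∀ {k l} x → k * l ≈ 1# → k *ₗ (l *ₗ x) ≈ᴹ x
  *ₗ-invertible {k} {l} x kl≈1 = begin
    k *ₗ (l *ₗ x)  ≈⟨ *ₗ-assoc k l x ⟨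
    (k * l) *ₗ x   ≈⟨ *ₗ-congʳ kl≈1 ⟩
    1# *ₗ x        ≈⟨ *ₗ-identityˡ x ⟩
    x              ∎

  module Cosets {p} {M : Pred Carrierᴹ p} (M-sub : IsSubspace M) (w : Carrierᴹ) where

    open IsSubspace M-sub

    -- x ≡ −k w modulo M: the coordinate of x along f is read off at w = −f.
    infix 4 _≡-_·w
    _≡-_·w : Carrierᴹ → Ring.Carrier R → Set p
    x ≡- k ·w = M (x +ᴹ k *ₗ w)

    coset-resp : ∀ {x y k l} → x ≈ᴹ y → k ≈ l → x ≡- k ·w → y ≡- l ·w
    coset-resp x≈y k≈l = resp (+ᴹ-cong x≈y (*ₗ-congʳ k≈l))

    coset-0 : ∀ {x} → M x → x ≡- 0# ·w
    coset-0 {x} = resp (begin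
      x              ≈⟨ +ᴹ-identityʳ x ⟨
      x +ᴹ 0ᴹ        ≈⟨ +ᴹ-congˡ (*ₗ-zeroˡ w) ⟨
      x +ᴹ 0# *ₗ w   ∎)

    coset-0⁻ : ∀ {x k} → k ≈ 0# → x ≡- k ·w → M x
    coset-0⁻ {x} {k} k≈0 = resp (begin
      x +ᴹ k *ₗ w   ≈⟨ +ᴹ-congˡ (*ₗ-congʳ k≈0) ⟩
      x +ᴹ 0# *ₗ w  ≈⟨ +ᴹ-congˡ (*ₗ-zeroˡ w) ⟩
      x +ᴹ 0ᴹ       ≈⟨ +ᴹ-identityʳ x ⟩
      x             ∎)

    coset-+ : ∀ {x y k l} → x ≡- k ·w → y ≡- l ·w → x +ᴹ y ≡- k + l ·w
    coset-+ {x} {y} {k} {l} p q = resp (begin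
      (x +ᴹ k *ₗ w) +ᴹ (y +ᴹ l *ₗ w)  ≈⟨ interchange x _ y _ ⟩
      (x +ᴹ y) +ᴹ (k *ₗ w +ᴹ l *ₗ w)  ≈⟨ +ᴹ-congˡ (*ₗ-distribʳ w k l) ⟨
      (x +ᴹ y) +ᴹ (k + l) *ₗ w        ∎) (+ᴹ-closed p q)

    coset-* : ∀ c {x k} → x ≡- k ·w → c *ₗ x ≡- c * k ·w
    coset-* c {x} {k} p = resp (begin
      c *ₗ (x +ᴹ k *ₗ w)         ≈⟨ *ₗ-distribˡ c x _ ⟩
      c *ₗ x +ᴹ c *ₗ (k *ₗ w)    ≈⟨ +ᴹ-congˡ (*ₗ-assoc c k w) ⟨
      c *ₗ x +ᴹ (c * k) *ₗ w     ∎) (*ₗ-closed c p)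

    coset-self : w ≡- - 1# ·w
    coset-self = resp (begin
      0ᴹ                 ≈⟨ -ᴹ‿inverseʳ w ⟨
      w +ᴹ -ᴹ w          ≈⟨ +ᴹ-congˡ (-1*ₗ w) ⟨
      w +ᴹ (- 1#) *ₗ w   ∎) 0ᴹ-closed

    coset-opposite : -ᴹ w ≡- 1# ·w
    coset-opposite = resp (begin
      0ᴹ                ≈⟨ -ᴹ‿inverseˡ w ⟨
      -ᴹ w +ᴹ w         ≈⟨ +ᴹ-congˡ (*ₗ-identityˡ w) ⟨
      -ᴹ w +ᴹ 1# *ₗ w   ∎) 0ᴹ-closed

    -- The predicate is the sum of `M` and the multiples of `w`, the candidate against which
    -- maximality of `M` is tested later.
    span-isSubspace : IsSubspace (λ x → ∃[ k ] x ≡- k ·w)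
    span-isSubspace = record
      { resp      = λ { x≈y (k , p) → k , coset-resp x≈y (Ring.refl R) p }
      ; 0ᴹ-closed = 0# , coset-0 0ᴹ-closed
      ; +ᴹ-closed = λ { (k , p) (l , q) → k + l , coset-+ p q }
      ; *ₗ-closed = λ { c (k , p) → c * k , coset-* c p }
      }

    -- Together the hypotheses say that the whole module is the direct sum of `M` and a free line
    -- spanned by `w`.
    module Coordinate (independent : ∀ {k} → M (k *ₗ w) → k ≈ 0#)
                      (spanning : ∀ x → ∃[ k ] x ≡- k ·w) where

      coordinate : Carrierᴹ → Ring.Carrier R
      coordinate x = proj₁ (spanning x)

      -- Adding -1 times the second membership to the first cancels `x` and leaves (k - l) w in `M`.
      coset-unique : ∀ {x k l} → x ≡- k ·w → x ≡- l ·w → k ≈ l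
      coset-unique {x} {k} {l} p q =
        x∙y⁻¹≈ε⇒x≈y k l (Ring.trans R (Ring.+-congˡ R (Ring.sym R (-1*x≈-x l))) (independent (resp (begin
          (x +ᴹ (- 1#) *ₗ x) +ᴹ (k + (- 1#) * l) *ₗ w  ≈⟨ +ᴹ-congʳ (+ᴹ-congˡ (-1*ₗ x)) ⟩
          (x +ᴹ -ᴹ x) +ᴹ (k + (- 1#) * l) *ₗ w         ≈⟨ +ᴹ-congʳ (-ᴹ‿inverseʳ x) ⟩
          0ᴹ +ᴹ (k + (- 1#) * l) *ₗ w                  ≈⟨ +ᴹ-identityˡ _ ⟩
          (k + (- 1#) * l) *ₗ w                        ∎)
          (coset-+ p (coset-* (- 1#) q)))))
        where
        open RingProperties R using (-1*x≈-x)
        open GroupProperties (Ring.+-group R) using (x∙y⁻¹≈ε⇒x≈y)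

      coordinate-unique : ∀ {x k} → x ≡- k ·w → coordinate x ≈ k
      coordinate-unique {x} = coset-unique (proj₂ (spanning x))

      -- `spanning` picks its scalar without regard to equality or the module structure; uniqueness
      -- of the scalar forces both to be respected.
      coordinate-isFunctional : IsFunctional coordinate
      coordinate-isFunctional = record
        { cong    = λ {x} {y} x≈y → coordinate-unique
                      (coset-resp (≈ᴹ-sym x≈y) (Ring.refl R) (proj₂ (spanning y)))
        ; +ᴹ-homo = λ x y → coordinate-unique
                      (coset-+ (proj₂ (spanning x)) (proj₂ (spanning y)))
        ; *ₗ-homo = λ k x → coordinate-unique (coset-* k (proj₂ (spanning x)))
        }

-- Separating a vector from a subspace by a linear functional.

module Separation {ℓ} (em : ExcludedMiddle ℓ) (ext : Extensionality ℓ ℓ)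
  (K : CommutativeRing ℓ ℓ) (K-field : IsField K)
  (E : LeftModule (CommutativeRing.ring K) ℓ ℓ) where

  open CommutativeRing K
  open LeftModule E
  open IsField K-field
  open Zorn em ext

  private
    Subspaceᵇ : (Carrierᴹ → Bool) → Set ℓ
    Subspaceᵇ P = IsSubspace E (_∈ᵇ P)

  ⟦⟧-isSubspace : ∀ {S : Pred Carrierᴹ ℓ} → IsSubspace E S → Subspaceᵇ ⟦ S ⟧ᵇ
  ⟦⟧-isSubspace {S} S-sub = record
    { resp      = λ x≈y → ∈⟦⟧⁺ S ∘ resp x≈y ∘ ∈⟦⟧⁻ S
    ; 0ᴹ-closed = ∈⟦⟧⁺ S 0ᴹ-closed
    ; +ᴹ-closed = λ x∈S y∈S → ∈⟦⟧⁺ S (+ᴹ-closed (∈⟦⟧⁻ S x∈S) (∈⟦⟧⁻ S y∈S))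
    ; *ₗ-closed = λ k → ∈⟦⟧⁺ S ∘ *ₗ-closed k ∘ ∈⟦⟧⁻ S
    }
    where open IsSubspace S-sub

  ⋃-isSubspace : ⋃-Closed Subspaceᵇ
  ⋃-isSubspace I (P₀ , P₀∈I) chain subspaces = record
    { resp      = λ x≈y x∈⋃ → case ∈⋃⁻ I x∈⋃ of λ where
                    (P , P∈I , x∈P) → ⊆⋃ I P∈I _ (IsSubspace.resp (subspaces P P∈I) x≈y x∈P)
    ; 0ᴹ-closed = ⊆⋃ I P₀∈I _ (IsSubspace.0ᴹ-closed (subspaces P₀ P₀∈I))
    ; +ᴹ-closed = λ x∈⋃ y∈⋃ → +-closed (∈⋃⁻ I x∈⋃) (∈⋃⁻ I y∈⋃)
    ; *ₗ-closed = λ k x∈⋃ → case ∈⋃⁻ I x∈⋃ of λ where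
                    (P , P∈I , x∈P) → ⊆⋃ I P∈I _ (IsSubspace.*ₗ-closed (subspaces P P∈I) k x∈P)
    }
    where
    +-closed : ∀ {x y} → ∃[ P ] P ∈ᵇ I × x ∈ᵇ P → ∃[ Q ] Q ∈ᵇ I × y ∈ᵇ Q → x +ᴹ y ∈ᵇ ⋃ I
    +-closed (P , P∈I , x∈P) (Q , Q∈I , y∈Q) with chain P Q P∈I Q∈I
    ... | inj₁ P⊆Q = ⊆⋃ I Q∈I _ (IsSubspace.+ᴹ-closed (subspaces Q Q∈I) (P⊆Q _ x∈P) y∈Q)
    ... | inj₂ Q⊆P = ⊆⋃ I P∈I _ (IsSubspace.+ᴹ-closed (subspaces P P∈I) x∈P (Q⊆P _ y∈Q))

  module _ {f : Carrierᴹ} {M : Carrierᴹ → Bool} (M-sub : Subspaceᵇ M) (f∉M : ¬ f ∈ᵇ M)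
    (maximal : ∀ Q → Subspaceᵇ Q × ¬ f ∈ᵇ Q → M ⊆ᵇ Q → Q ⊆ᵇ M) where

    open IsSubspace M-sub
    open Cosets E M-sub

    independent : ∀ {k} → k *ₗ (-ᴹ f) ∈ᵇ M → k ≈ 0#
    independent {k} kf∈M with em {k ≈ 0#}
    ... | yes k≈0 = k≈0
    ... | no  k≉0 with inverse k k≉0
    ...   | l , kl≈1 = ⊥-elim (f∉M (resp f′≈f (*ₗ-closed (- 1#) (*ₗ-closed l kf∈M))))
      where
      open SetoidReasoning ≈ᴹ-setoid
      f′≈f = begin
        (- 1#) *ₗ (l *ₗ (k *ₗ (-ᴹ f)))  ≈⟨ *ₗ-congˡ (*ₗ-invertible E _ (trans (*-comm l k) kl≈1)) ⟩
        (- 1#) *ₗ (-ᴹ f)                ≈⟨ -1*ₗ E _ ⟩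
        -ᴹ (-ᴹ f)                       ≈⟨ GroupProperties.⁻¹-involutive +ᴹ-group f ⟩
        f                               ∎

    -- Either M + Kx still misses `f`, and then maximality puts `x` into `M`, or some f + kx lies in
    -- `M` with `k` invertible, and this relation is solved for `x`.
    spanning : ∀ x → ∃[ k ] x +ᴹ k *ₗ (-ᴹ f) ∈ᵇ M
    spanning x with em {∃[ k ] f +ᴹ k *ₗ x ∈ᵇ M}
    ... | no f∉M+x = 0# , coset-0 (-ᴹ f)
      (maximal ⟦ M+x ⟧ᵇ (⟦⟧-isSubspace (span-isSubspace x) , f∉M+x ∘ ∈⟦⟧⁻ M+x)
        (λ y y∈M → ∈⟦⟧⁺ M+x (0# , coset-0 x y∈M)) x (∈⟦⟧⁺ M+x (- 1# , coset-self x)))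
      where
      M+x : Pred Carrierᴹ ℓ
      M+x y = ∃[ k ] y +ᴹ k *ₗ x ∈ᵇ M
    ... | yes (k , f+kx∈M) with em {k ≈ 0#}
    ...   | yes k≈0 = ⊥-elim (f∉M (coset-0⁻ x k≈0 f+kx∈M))
    ...   | no  k≉0 with inverse k k≉0
    -- Scaling f + kx by the inverse `l` of `k` gives x + lf; writing f as (-1)(-f) yields the
    -- coefficient of -f.
    ...     | l , kl≈1 = l * - 1# , resp (begin
      l *ₗ (f +ᴹ k *ₗ x)                    ≈⟨ *ₗ-distribˡ l f _ ⟩
      l *ₗ f +ᴹ l *ₗ (k *ₗ x)               ≈⟨ +ᴹ-comm _ _ ⟩
      l *ₗ (k *ₗ x) +ᴹ l *ₗ f               ≈⟨ +ᴹ-cong (*ₗ-invertible E x (trans (*-comm l k) kl≈1)) (*ₗ-congˡ f≈) ⟩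
      x +ᴹ l *ₗ ((- 1#) *ₗ (-ᴹ f))          ≈⟨ +ᴹ-congˡ (*ₗ-assoc l (- 1#) _) ⟨
      x +ᴹ (l * - 1#) *ₗ (-ᴹ f)             ∎)
      (*ₗ-closed l f+kx∈M)
      where
      open SetoidReasoning ≈ᴹ-setoid
      f≈ : f ≈ᴹ (- 1#) *ₗ (-ᴹ f)
      f≈ = ≈ᴹ-sym (≈ᴹ-trans (-1*ₗ E _) (GroupProperties.⁻¹-involutive +ᴹ-group f))

    open Coordinate (-ᴹ f) independent spanning public

    coordinate-f : coordinate f ≈ 1#
    coordinate-f = coordinate-unique
      (coset-resp (-ᴹ f) (GroupProperties.⁻¹-involutive +ᴹ-group f) refl (coset-opposite (-ᴹ f)))

    coordinate-M : ∀ {x} → x ∈ᵇ M → coordinate x ≈ 0#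
    coordinate-M x∈M = coordinate-unique (coset-0 (-ᴹ f) x∈M)

  separate : ∀ {S : Pred Carrierᴹ ℓ} → IsSubspace E S → ∀ {f} → ¬ S f →
             ∃[ φ ] IsFunctional E φ × (∀ {x} → S x → φ x ≈ 0#) × φ f ≈ 1#
  separate {S} S-sub {f} f∉S
    with zorn (λ P → Subspaceᵇ P × ¬ f ∈ᵇ P)
           (λ I i chain good →
             ⋃-isSubspace I i chain (λ P → proj₁ ∘ good P) ,
             λ f∈⋃ → case ∈⋃⁻ I f∈⋃ of λ where
               (P , P∈I , f∈P) → proj₂ (good P P∈I) f∈P)
           (⟦⟧-isSubspace S-sub , f∉S ∘ ∈⟦⟧⁻ S)
  ... | M , (M-sub , f∉M) , S⊆M , maximal =
    coordinate M-sub f∉M maximal , coordinate-isFunctional M-sub f∉M maximal ,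
    (λ x∈S → coordinate-M M-sub f∉M maximal (S⊆M _ (∈⟦⟧⁺ S x∈S))) ,
    coordinate-f M-sub f∉M maximal

-- Centralizers as clones.

module Commutation {ℓ} (A : Setoid ℓ ℓ) where

  open Setoid A
  open Operations A

  ⊥-sym : ∀ {X Y} {f : Operation X} {g : Operation Y} → f ⊥ g → g ⊥ f
  ⊥-sym f⊥g a = sym (f⊥g λ x y → a y x)

  ⊥-respˡ : ∀ {X Y} {f f′ : Operation X} {g : Operation Y} → f ≈ₒ f′ → f ⊥ g → f′ ⊥ g
  ⊥-respˡ {g = g} f≈f′ f⊥g a =
    trans (Func.cong g λ y → sym (f≈f′ _)) (trans (f⊥g a) (f≈f′ _))

  ⊥-respʳ : ∀ {X Y} {f : Operation X} {g g′ : Operation Y} → g ≈ₒ g′ → f ⊥ g → f ⊥ g′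
  ⊥-respʳ {f = f} {g} {g′} g≈g′ f⊥g =
    ⊥-sym {f = g′} {f} (⊥-respˡ {f = g} {g′} {f} g≈g′ (⊥-sym {f = f} {g} f⊥g))

  -- An operation `h` passes through a composite layer by layer: first through the outer `f`, then
  -- through each inner `g y`.
  ^⊥-isClone : ∀ {p} (G : OperationSet p) → IsClone (G ^⊥)
  ^⊥-isClone G = record
    { resp            = λ {_} {f} {f′} f≈f′ f∈ h h∈G → ⊥-respˡ {f = f} {f′} {h} f≈f′ (f∈ h h∈G)
    ; hasProjections  = λ x h h∈G a → refl
    ; closedUnderComp = λ f g f∈ g∈ h h∈G a →
        trans (f∈ h h∈G _) (Func.cong f λ y → g∈ y h h∈G a)
    }

  ⊆-^⊥⊥ : ∀ {p} (G : OperationSet p) X → G X ⊆ (G ^⊥⊥) X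
  ⊆-^⊥⊥ G X {f} f∈G g g∈G^⊥ = ⊥-sym {f = g} {f} (g∈G^⊥ f f∈G)

  -- A double centralizer is in particular a centralizer, hence a clone, and it contains `G`.
  ⟨⟩⊆^⊥⊥ : ∀ {p} (G : OperationSet p) X → ⟨ G ⟩ X ⊆ (G ^⊥⊥) X
  ⟨⟩⊆^⊥⊥ G = ⟨⟩-least (^⊥-isClone (G ^⊥)) (⊆-^⊥⊥ G)

-- Linear operations and finite linear combinations.

module Linear {ℓ} (K : CommutativeRing ℓ ℓ) (V : Module K ℓ ℓ) where

  open CommutativeRing K using (ring; _≈_; 0#; 1#; -_) renaming (Carrier to Scalar)
  open Module V
  open VectorSpace K V
  open Commutation ≈ᴹ-setoid

  powerModule : Set ℓ → LeftModule ring ℓ ℓ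
  powerModule X = pointwise X leftModule

  module _ {Y : Set ℓ} where

    open LeftModule (powerModule Y) public
      using () renaming (_+ᴹ_ to _⊕_; _*ₗ_ to _⊛_)

  -- Commuting with addition and scaling is additivity and homogeneity read backwards; zero and
  -- negation are handled as scaling by 0 and by -1.
  linear∈Σⱽ^⊥ : ∀ {Y} (g : Operation Y) →
                (∀ a b → g ⟨$⟩ (a ⊕ b) ≈ᴹ (g ⟨$⟩ a) +ᴹ (g ⟨$⟩ b)) →
                (∀ c a → g ⟨$⟩ (c ⊛ a) ≈ᴹ c *ₗ (g ⟨$⟩ a)) →
                g ∈ (Σⱽ ^⊥) Y
  linear∈Σⱽ^⊥ {Y} g g-+ g-* f (basic s f≈) =
    ⊥-respʳ {f = g} {⟦ s ⟧} {f} (≈ᴹ-sym ∘ f≈) (commutes s)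
    where
    open SetoidReasoning ≈ᴹ-setoid
    commutes : ∀ s → g ⊥ ⟦ s ⟧
    commutes add a = ≈ᴹ-sym (g-+ _ _)
    commutes zero a = begin
      0ᴹ                        ≈⟨ *ₗ-zeroˡ _ ⟨
      0# *ₗ (g ⟨$⟩ λ _ → 0ᴹ)    ≈⟨ g-* 0# _ ⟨
      (g ⟨$⟩ λ _ → 0# *ₗ 0ᴹ)    ≈⟨ Func.cong g (λ _ → *ₗ-zeroˡ 0ᴹ) ⟩
      (g ⟨$⟩ λ _ → 0ᴹ)          ∎
    commutes neg a = begin
      -ᴹ (g ⟨$⟩ b)              ≈⟨ -1*ₗ leftModule _ ⟨
      (- 1#) *ₗ (g ⟨$⟩ b)       ≈⟨ g-* (- 1#) b ⟨
      (g ⟨$⟩ ((- 1#) ⊛ b))      ≈⟨ Func.cong g (λ y → -1*ₗ leftModule (b y)) ⟩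
      (g ⟨$⟩ λ y → -ᴹ b y)      ∎
      where
      b : Y → Carrierᴹ
      b y = a y (lift fzero)
    commutes (scale c) a = ≈ᴹ-sym (g-* c _)

  -- Membership in `⟨ Σⱽ ⟩` lives in a universe above `ℓ`, out of reach of `ExcludedMiddle ℓ`. Terms
  -- capture the finite linear combinations of projections inside `Set ℓ`; negation is scaling by
  -- -1.
  data Term (X : Set ℓ) : Set ℓ where
    var     : X → Term X
    zero    : Term X
    _`+_    : Term X → Term X → Term X
    _`*_    : Scalar → Term X → Term X

  eval : ∀ {X} → Term X → (X → Carrierᴹ) → Carrierᴹ
  eval (var x)  a = a x
  eval zero     a = 0ᴹ
  eval (s `+ t) a = eval s a +ᴹ eval t a
  eval (c `* t) a = c *ₗ eval t a

  eval-derived : ∀ {X} (t : Term X) {f : Operation X} →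
                 (∀ a → f ⟨$⟩ a ≈ᴹ eval t a) → f ∈ ⟨ Σⱽ ⟩ X
  eval-derived t f≈ = resp (λ a → ≈ᴹ-trans (operation-eval t a) (≈ᴹ-sym (f≈ a))) (derived t)
    where
    nullary : ∀ {X} → Lift ℓ (Fin 0) → Operation X
    nullary ()

    binary : ∀ {X} → Operation X → Operation X → Lift ℓ (Fin 2) → Operation X
    binary f g (lift fzero)    = f
    binary f g (lift (fsuc _)) = g

    operation : ∀ {X} → Term X → Operation X
    operation (var x)  = π x
    operation zero     = compose ⟦ zero ⟧ nullary
    operation (s `+ t) = compose ⟦ add ⟧ (binary (operation s) (operation t))
    operation (c `* t) = compose ⟦ scale c ⟧ λ _ → operation t

    operation-eval : ∀ {X} (t : Term X) a → operation t ⟨$⟩ a ≈ᴹ eval t a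
    operation-eval (var x)  a = ≈ᴹ-refl
    operation-eval zero     a = ≈ᴹ-refl
    operation-eval (s `+ t) a = +ᴹ-cong (operation-eval s a) (operation-eval t a)
    operation-eval (c `* t) a = *ₗ-congˡ (operation-eval t a)

    basic∈ : ∀ s → ⟦ s ⟧ ∈ ⟨ Σⱽ ⟩ _
    basic∈ s = gen (basic s λ _ → ≈ᴹ-refl)

    derived : ∀ {X} (t : Term X) → operation t ∈ ⟨ Σⱽ ⟩ X
    derived (var x)  = proj x
    derived zero     = comp ⟦ zero ⟧ nullary (basic∈ zero) λ ()
    derived (s `+ t) = comp ⟦ add ⟧ (binary (operation s) (operation t)) (basic∈ add) λ where
      (lift fzero)    → derived s
      (lift (fsuc _)) → derived t
    derived (c `* t) = comp ⟦ scale c ⟧ (λ _ → operation t) (basic∈ (scale c)) λ _ → derived t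

  -- Stated for bare maps because the ambient module `powerModule (X → Carrierᴹ)` also contains maps
  -- that need not respect `≈ᴹ`.
  TermFunction : ∀ {X} → Pred ((X → Carrierᴹ) → Carrierᴹ) ℓ
  TermFunction h = ∃[ t ] (∀ a → h a ≈ᴹ eval t a)

  termFunctions-isSubspace : ∀ {X} → IsSubspace (powerModule (X → Carrierᴹ)) TermFunction
  termFunctions-isSubspace = record
    { resp      = λ { f≈g (t , f≈) → t , λ a → ≈ᴹ-trans (≈ᴹ-sym (f≈g a)) (f≈ a) }
    ; 0ᴹ-closed = zero , λ _ → ≈ᴹ-refl
    ; +ᴹ-closed = λ { (s , f≈) (t , g≈) → s `+ t , λ a → +ᴹ-cong (f≈ a) (g≈ a) }
    ; *ₗ-closed = λ { c (t , f≈) → c `* t , λ a → *ₗ-congˡ (f≈ a) }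
    }

  functional-operation : ∀ {Y} {φ : (Y → Carrierᴹ) → Scalar} →
                         IsFunctional (powerModule Y) φ → Carrierᴹ → Operation Y
  functional-operation {φ = φ} φ-functional v = record
    { to   = λ a → φ a *ₗ v
    ; cong = λ a≈b → *ₗ-congʳ (IsFunctional.cong φ-functional a≈b)
    }

  functional-operation∈Σⱽ^⊥ : ∀ {Y} {φ : (Y → Carrierᴹ) → Scalar}
    (φ-functional : IsFunctional (powerModule Y) φ) v →
    functional-operation φ-functional v ∈ (Σⱽ ^⊥) Y
  functional-operation∈Σⱽ^⊥ φ-functional v = linear∈Σⱽ^⊥ (functional-operation φ-functional v)
    (λ a b → ≈ᴹ-trans (*ₗ-congʳ (+ᴹ-homo a b)) (*ₗ-distribʳ v _ _))
    (λ c a → ≈ᴹ-trans (*ₗ-congʳ (*ₗ-homo c a)) (*ₗ-assoc c _ v))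
    where open IsFunctional φ-functional

  zeroOperation : ∀ Y → Operation Y
  zeroOperation Y = record { to = λ _ → 0ᴹ ; cong = λ _ → ≈ᴹ-refl }

  -- The constant zero operation is linear, so `f` commutes with it.
  ^⊥⊥-zero : ∀ {X} {f : Operation X} → f ∈ (Σⱽ ^⊥⊥) X → f ⟨$⟩ (λ _ → 0ᴹ) ≈ᴹ 0ᴹ
  ^⊥⊥-zero {X} {f} f∈ = ≈ᴹ-sym (f∈ (zeroOperation X)
    (linear∈Σⱽ^⊥ (zeroOperation X) (λ _ _ → ≈ᴹ-sym (+ᴹ-identityˡ 0ᴹ)) (λ c _ → ≈ᴹ-sym (*ₗ-zeroʳ c)))
    λ _ _ → 0ᴹ)

  -- The double centralizer consists of term functions.

  module _ (em : ExcludedMiddle ℓ) (ext : Extensionality ℓ ℓ) (K-field : IsField K) where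

    ^⊥⊥⇒¬separated : ∀ {X} {f : Operation X} → f ∈ (Σⱽ ^⊥⊥) X →
      ∀ {φ} → IsFunctional (powerModule (X → Carrierᴹ)) φ →
      (∀ x → φ (λ y → y x) ≈ 0#) → φ (f ⟨$⟩_) ≈ 1# → ∀ v → v ≈ᴹ 0ᴹ
    ^⊥⊥⇒¬separated {f = f} f∈ {φ} φ-functional φπ≈0 φf≈1 v = begin
      v                                      ≈⟨ *ₗ-identityˡ v ⟨
      1# *ₗ v                                ≈⟨ *ₗ-congʳ φf≈1 ⟨
      -- The matrix is indexed by `X` and by all tuples `y`, with entry `y x`: its row at `x` is the
      -- projection to `x`, and its column at `y` is `y` itself, which `f` sends to `f ⟨$⟩ y`.
      φ (f ⟨$⟩_) *ₗ v                        ≈⟨ f∈ (functional-operation φ-functional v)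
                                                  (functional-operation∈Σⱽ^⊥ φ-functional v)
                                                  (λ x y → y x) ⟩
      (f ⟨$⟩ λ x → φ (λ y → y x) *ₗ v)       ≈⟨ Func.cong f (λ x → *ₗ-congʳ (φπ≈0 x)) ⟩
      (f ⟨$⟩ λ x → 0# *ₗ v)                  ≈⟨ Func.cong f (λ x → *ₗ-zeroˡ v) ⟩
      (f ⟨$⟩ λ x → 0ᴹ)                       ≈⟨ ^⊥⊥-zero {f = f} f∈ ⟩
      0ᴹ                                     ∎
      where open SetoidReasoning ≈ᴹ-setoid

    ^⊥⊥⇒TermFunction : Nonzero → ∀ {X} {f : Operation X} →
                       f ∈ (Σⱽ ^⊥⊥) X → TermFunction (f ⟨$⟩_)
    ^⊥⊥⇒TermFunction (v , v≉0) {X} {f} f∈ = decidable-stable em λ ¬f-term →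
      let φ , φ-functional , φ-term , φf≈1 =
            Separation.separate em ext K K-field (powerModule (X → Carrierᴹ))
              termFunctions-isSubspace ¬f-term
      in v≉0 (^⊥⊥⇒¬separated {f = f} f∈ φ-functional
                (λ x → φ-term (var x , λ _ → ≈ᴹ-refl)) φf≈1 v)

theorem7p1 : (ℓ : Level) → ExcludedMiddle ℓ → Extensionality ℓ ℓ →
    (K : CommutativeRing ℓ ℓ) → IsField K →
    (V : Module K ℓ ℓ) → (let open VectorSpace K V) → Nonzero →
    ∀ X → (Σⱽ ^⊥⊥) X ≐ ⟨ Σⱽ ⟩ X
theorem7p1 ℓ em ext K K-field V V≢0 X =
  (λ {f} f∈ → let t , f≈t = ^⊥⊥⇒TermFunction em ext K-field V≢0 {f = f} f∈
              in eval-derived t f≈t) ,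
  ⟨⟩⊆^⊥⊥ Σⱽ X
  where
  open Linear K V
  open VectorSpace K V
  open Commutation (Module.≈ᴹ-setoid V)
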